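{- For any $d\geq 2$ and any $n_1\geq\cdots\geq n_d\geq 1$ it holds \[\mathrm{qc}(n_1, n_2, \dots, n_d) \in O \left( \prod_{i = 2}^{d} n_i \left( \log_2 \frac{n_1}{n_{2}} + 1 \right) \right).\]
   Context: Search game on the grid $S_1\times\cdots\times S_d$ with $S_i=\{0,\ldots,n_i-1\}$: Adversary fixes a target $t$; Algorithm queries a point $q$; if $q\neq t$, Adversary answers for every coordinate $i$ one of $t_i<q_i$ or $t_i>q_i$, at least one of these $d$ inequalities being true, and Algorithm does not learn which one. $\mathrm{qc}(n_1,\ldots,n_d)$ denotes the minimum number of queries that guarantees finding the target (the query complexity). -}

module Defs where

open import Data.Nat using (ℕ; zero; suc; _*_; _<_; _≤_; _/_; >-nonZero)
open import Data.Nat.Logarithm using (⌊log₂_⌋)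
open import Data.Fin using (Fin; zero; suc)
open import Data.Bool using (Bool; true; false)
open import Data.Product using (Σ; ∃; _×_)
open import Data.Sum using (_⊎_)
open import Data.Empty using (⊥)
open import Relation.Binary.PropositionalEquality using (_≡_)

Point : ∀ {d} → (Fin d → ℕ) → Set
Point {d} n = (i : Fin d) → Fin (n i)

_≈ₚ_ : ∀ {d} {n : Fin d → ℕ} → Point n → Point n → Set
_≈ₚ_ {d} q t = (i : Fin d) → q i ≡ t i

-- An answer of the Adversary: for every coordinate i one of the two
-- inequalities; false encodes "t_i < q_i", true encodes "t_i > q_i".
Answer : ℕ → Set
Answer d = Fin d → Bool

Claim : ∀ {d} {n : Fin d → ℕ} → Point n → Point n → Answer d → Fin d → Set
Claim t q a i with a i
... | false = Data.Fin._<_ (t i) (q i)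
... | true  = Data.Fin._<_ (q i) (t i)

-- An answer is admissible for target t at query q iff at least one of
-- the d claimed inequalities is true (this forces q ≠ t).
Admissible : ∀ {d} {n : Fin d → ℕ} → Point n → Point n → Answer d → Set
Admissible t q a = ∃ λ i → Claim t q a i

-- Deterministic adaptive algorithms making at most k queries, as decision
-- trees of depth k: each node queries a point and branches on the answer.
data Alg {d} (n : Fin d → ℕ) : ℕ → Set where
  stop : Alg n zero
  ask  : ∀ {k} → Point n → (Answer d → Alg n k) → Alg n (suc k)

-- Algorithm A finds target t against every Adversary answering
-- admissibly with respect to t (the Algorithm only sees the answers).
Finds : ∀ {d} {n : Fin d → ℕ} {k} → Alg n k → Point n → Set
Finds stop t = ⊥
Finds (ask q f) t = (q ≈ₚ t) ⊎ ((a : Answer _) → Admissible t q a → Finds (f a) t)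

qc≤ : ∀ {d} → (Fin d → ℕ) → ℕ → Set
qc≤ n k = Σ (Alg n k) λ A → ∀ t → Finds A t

∏ : ∀ {k} → (Fin k → ℕ) → ℕ
∏ {zero} f = 1
∏ {suc k} f = f zero * ∏ (λ i → f (suc i))

⌊log₂_/_⌋ : (a b : ℕ) → 1 ≤ b → ℕ
⌊log₂ a / b ⌋ p = ⌊log₂ _/_ a b {{>-nonZero p}} ⌋

{-# OPTIONS --safe #-}
-- Fixing the coordinates from the third on costs a factor n₃⋯n_d, and an
-- answer to a query inside such a slice removes a closed quadrant of the slice,
-- so it suffices to search an n₁ × n₂ rectangle.  Binary search along its
-- middle row ends at a cut x: some quadrant reaching up to x from the left and
-- some quadrant reaching down to x from the right have been removed.  What
-- is left is one half (by rows) of the rectangle, or opposite parts of the two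
-- halves whose widths sum to the original width.  Recursing, the rectangles h
-- levels above the leaves have width about 2^(E+h) with 2^E ≈ n₁/n₂, and
-- searching a row of width a costs at most (E+h) + a/2^(E+h).  Summed over
-- the tree, the first terms give O(2^h (E+2)) and the second at most a/2^E ≤ n₂.
module Submission where

open import Defs
open import Data.Bool using (Bool; true; false)
open import Data.Nat using (ℕ; zero; suc; _+_; _*_; _∸_; _^_; _/_; _≤_; _<_; z≤n; s≤s; s≤s⁻¹; NonZero; >-nonZero)
open import Data.Nat.DivMod using (m/n*n≤m; m*n/n≡m; /-monoˡ-≤; m≡m%n+[m/n]*n; m%n<n)
open import Data.Nat.Logarithm using (⌊log₂⌋-mono-≤; ⌊log₂[2^n]⌋≡n) renaming (⌊log₂_⌋ to log₂)
open import Data.Nat.Properties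
open import Data.Nat.Tactic.RingSolver using (solve-∀)
open import Data.Fin using (Fin; zero; suc; toℕ; fromℕ<)
open import Data.Fin.Properties using (toℕ-fromℕ<; toℕ<n)
open import Data.Product using (∃; _×_; _,_; proj₁; proj₂)
open import Data.Sum using (_⊎_; inj₁; inj₂; [_,_]′)
open import Data.Unit using (⊤; tt)
open import Function using (_∘_)
open import Level using (0ℓ)
open import Relation.Nullary using (¬_; yes; no; contradiction)
open import Relation.Unary using (Pred; _⊆_; _∪_)
open import Relation.Binary.PropositionalEquality using (_≡_; refl; sym; trans; cong; subst)
open import Relation.Binary.Definitions using (tri<; tri≈; tri>)

-- Combining query strategies.

module Search {d} {n : Fin d → ℕ} (origin : Point n) where

  Region : Set₁
  Region = Pred (Point n) 0ℓ

  Searchable : Region → ℕ → Set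
  Searchable S k = ∃ λ (A : Alg n k) → ∀ t → S t → Finds A t

  append : ∀ {j k} → Alg n j → Alg n k → Alg n (j + k)
  append stop      B = B
  append (ask q f) B = ask q λ a → append (f a) B

  append-findsˡ : ∀ {j k t} (A : Alg n j) {B : Alg n k} → Finds A t → Finds (append A B) t
  append-findsˡ (ask q f) (inj₁ q≈t) = inj₁ q≈t
  append-findsˡ (ask q f) (inj₂ F)   = inj₂ λ a adm → append-findsˡ (f a) (F a adm)

  append-findsʳ : ∀ {j k t} (A : Alg n j) {B : Alg n k} → Finds B t → Finds (append A B) t
  append-findsʳ stop      F = F
  append-findsʳ (ask q f) F = inj₂ λ a _ → append-findsʳ (f a) F

  idle : ∀ k → Alg n k
  idle zero    = stop
  idle (suc k) = ask origin λ _ → idle k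

  shrink : ∀ {S S′ : Region} {k} → S′ ⊆ S → Searchable S k → Searchable S′ k
  shrink sub (A , F) = A , λ t → F t ∘ sub

  pad : ∀ {S j k} → j ≤ k → Searchable S j → Searchable S k
  pad {S} {j} j≤k (A , F) = subst (Searchable S) (m+[n∸m]≡n j≤k)
    (append A (idle _) , λ t St → append-findsˡ A (F t St))

  empty : ∀ {S : Region} {k} → (∀ {t} → ¬ S t) → Searchable S k
  empty none = idle _ , λ t St → contradiction St none

  union : ∀ {S S′ j k} → Searchable S j → Searchable S′ k → Searchable (S ∪ S′) (j + k)
  union (A , F) (B , G) = append A B , λ t →
    [ (λ St → append-findsˡ A (F t St)) , (λ S′t → append-findsʳ A (G t S′t)) ]′

  unionFin : ∀ {k} N {S : Fin N → Region} → (∀ x → Searchable (S x) k) →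
             Searchable (λ t → ∃ λ x → S x t) (N * k)
  unionFin zero    W = empty λ ()
  unionFin (suc N) W = shrink (λ { (zero , St) → inj₁ St ; (suc x , St) → inj₂ (x , St) })
    (union (W zero) (unionFin N (W ∘ suc)))

  -- Fixing the first coordinate of `π` moves that equation into the region, so the induction spends
  -- one `unionFin` per coordinate.
  fibrewise : ∀ {k m} {n′ : Fin m → ℕ} (π : Point n → Point n′) {S : Region} →
              (∀ c → Searchable (λ t → S t × (π t ≈ₚ c)) k) → Searchable S (∏ n′ * k)
  fibrewise {k} {zero} π W =
    subst (Searchable _) (sym (*-identityˡ k)) (shrink (_, λ ()) (W λ ()))
  fibrewise {k} {suc m} {n′} π {S} W =
    subst (Searchable S) (sym (*-assoc (n′ zero) _ k))
      (shrink (λ St → _ , St , refl)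
        (unionFin (n′ zero) λ x →
          fibrewise (λ t i → π t (suc i)) {λ t → S t × π t zero ≡ x} λ c →
            shrink (λ { ((St , eq) , eqs) → St , λ { zero → eq ; (suc i) → eqs i } })
              (W λ { zero → x ; (suc i) → c i })))

  -- A hit needs no case of its own: if `q` is the target, no answer is admissible and the second
  -- alternative of `Finds` holds vacuously.
  query : ∀ {S : Region} {k} q → (∀ a → Searchable (λ t → S t × Admissible t q a) k) →
          Searchable S (suc k)
  query q W = ask q (λ a → proj₁ (W a)) ,
    λ t St → inj₂ λ a adm → proj₂ (W a) t (St , adm)

-- Truth of a single claimed inequality.

Says : Bool → ℕ → ℕ → Set
Says false t q = t < q
Says true  t q = q < t

-- The complement of `Says` keeps the boundary, so a queried row lies on the denied side for either
-- bit.
Denies : Bool → ℕ → ℕ → Set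
Denies false t q = q ≤ t
Denies true  t q = t ≤ q

¬says∧denies : ∀ b {t q} → Says b t q → ¬ Denies b t q
¬says∧denies false = <⇒≱
¬says∧denies true  = <⇒≱

claim⇒says : ∀ {d} {n : Fin d → ℕ} {t q : Point n} (a : Answer d) i →
             Claim t q a i → Says (a i) (toℕ (t i)) (toℕ (q i))
claim⇒says a i c with a i
... | false = c
... | true  = c

says-irrefl : ∀ b {t q} → t ≡ q → ¬ Says b t q
says-irrefl false t≡q = <-irrefl t≡q
says-irrefl true  t≡q = <-irrefl (sym t≡q)

-- Powers of two and truncated division.

2^-double : ∀ a g → a + 2 ^ suc g ≡ (a + 2 ^ g) + 2 ^ g
2^-double a g = lemma a (2 ^ g)
  where
  lemma : ∀ a z → a + 2 * z ≡ (a + z) + z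
  lemma = solve-∀

0<2^ : ∀ g → 0 < 2 ^ g
0<2^ g = m^n>0 2 g

-- The pivot of both halvings: `x` closes the block of length `2 ^ g` from `a`, so of fewer than
-- `2 ^ suc g` rows fewer than `2 ^ g` remain on each side of it.
blockEnd : ∀ a g → ∃ λ x → suc x ≡ a + 2 ^ g × a ≤ x
blockEnd a g with 2 ^ g | 0<2^ g
... | suc z | _ = a + z , sym (+-suc a z) , m≤m+n a z

superadditive-/ : ∀ a b k .{{_ : NonZero k}} → a / k + b / k ≤ (a + b) / k
superadditive-/ a b k = begin
  a / k + b / k               ≡⟨ m*n/n≡m (a / k + b / k) k ⟨
  (a / k + b / k) * k / k     ≡⟨ cong (_/ k) (*-distribʳ-+ k (a / k) (b / k)) ⟩
  (a / k * k + b / k * k) / k ≤⟨ /-monoˡ-≤ k (+-mono-≤ (m/n*n≤m a k) (m/n*n≤m b k)) ⟩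
  (a + b) / k                 ∎
  where open ≤-Reasoning

_/2^_ : ℕ → ℕ → ℕ
a /2^ e = (a / 2 ^ e) {{m^n≢0 2 e}}

/2^-superadditive : ∀ a b e → a /2^ e + b /2^ e ≤ (a + b) /2^ e
/2^-superadditive a b e = superadditive-/ a b (2 ^ e) {{m^n≢0 2 e}}

/2^-halve : ∀ a e → a /2^ suc e + a /2^ suc e ≤ a /2^ e
/2^-halve a e = begin
  q + q                   ≡⟨ m*n/n≡m (q + q) (2 ^ e) ⟨
  (q + q) * 2 ^ e / 2 ^ e ≡⟨ cong (_/ 2 ^ e) (lemma q (2 ^ e)) ⟩
  q * 2 ^ suc e / 2 ^ e   ≤⟨ /-monoˡ-≤ (2 ^ e) (m/n*n≤m a (2 ^ suc e)) ⟩
  a / 2 ^ e               ∎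
  where
  open ≤-Reasoning
  instance
    _ = m^n≢0 2 e
    _ = m^n≢0 2 (suc e)
  q = a /2^ suc e
  lemma : ∀ q z → (q + q) * z ≡ q * (2 * z)
  lemma = solve-∀

n<2^n : ∀ n → n < 2 ^ n
n<2^n zero    = s≤s z≤n
n<2^n (suc n) = subst (suc (suc n) ≤_) (sym (2^-double 0 n)) (+-mono-≤ (0<2^ n) (n<2^n n))

m<[1+m/n]*n : ∀ m n .{{_ : NonZero n}} → m < suc (m / n) * n
m<[1+m/n]*n m n = subst (_< suc (m / n) * n) (sym (m≡m%n+[m/n]*n m n))
  (+-monoˡ-< (m / n * n) (m%n<n m n))

-- The tangent to log₂ at 2 ^ e.
<2^[e+/2^e] : ∀ a e → a < 2 ^ (e + a /2^ e)
<2^[e+/2^e] a e = begin-strict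
  a                      <⟨ m<[1+m/n]*n a (2 ^ e) {{m^n≢0 2 e}} ⟩
  suc (a /2^ e) * 2 ^ e  ≤⟨ *-monoˡ-≤ (2 ^ e) (n<2^n (a /2^ e)) ⟩
  2 ^ (a /2^ e) * 2 ^ e  ≡⟨ *-comm (2 ^ (a /2^ e)) (2 ^ e) ⟩
  2 ^ e * 2 ^ (a /2^ e)  ≡⟨ ^-distribˡ-+-* 2 e (a /2^ e) ⟨
  2 ^ (e + a /2^ e)      ∎
  where open ≤-Reasoning

-- Cost of the recursion.

-- cost E h a bounds the search of a rectangle of width a with fewer than
-- 2 ^ h rows: level h of the recursion uses the tangent at 2 ^ (E + h).
rowCost : ℕ → ℕ → ℕ → ℕ
rowCost E h a = (E + suc h) + a /2^ (E + suc h)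

base : ℕ → ℕ → ℕ
base E zero    = 0
base E (suc h) = (E + suc h) + 2 * base E h

excess : ℕ → ℕ → ℕ → ℕ
excess E zero    a = 0
excess E (suc h) a = a /2^ (E + suc h) + excess E h a

cost : ℕ → ℕ → ℕ → ℕ
cost E h a = base E h + excess E h a

<2^rowCost : ∀ E h a → a < 2 ^ rowCost E h a
<2^rowCost E h a = <2^[e+/2^e] a (E + suc h)

cost-suc : ∀ E h a → rowCost E h a + (2 * base E h + excess E h a) ≡ cost E (suc h) a
cost-suc E h a = lemma (E + suc h) (a /2^ (E + suc h)) (2 * base E h) (excess E h a)
  where
  lemma : ∀ p q r s → p + q + (r + s) ≡ p + r + (q + s)
  lemma = solve-∀

cost-mono : ∀ E h a → cost E h a ≤ cost E (suc h) a
cost-mono E h a = subst (cost E h a ≤_) (cost-suc E h a)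
  (≤-trans (+-monoˡ-≤ (excess E h a) (m≤m+n (base E h) _)) (m≤n+m _ (rowCost E h a)))

excess-superadditive : ∀ E h a b → excess E h a + excess E h b ≤ excess E h (a + b)
excess-superadditive E zero    a b = z≤n
excess-superadditive E (suc h) a b = begin
  (p + excess E h a) + (q + excess E h b) ≡⟨ lemma p (excess E h a) q (excess E h b) ⟩
  (p + q) + (excess E h a + excess E h b) ≤⟨ +-mono-≤ (/2^-superadditive a b (E + suc h)) (excess-superadditive E h a b) ⟩
  excess E (suc h) (a + b)                ∎
  where
  open ≤-Reasoning
  p = a /2^ (E + suc h)
  q = b /2^ (E + suc h)
  lemma : ∀ p x q y → (p + x) + (q + y) ≡ (p + q) + (x + y)
  lemma = solve-∀

-- Pays for two opposite parts of widths `a` and `b`: the width-free `base` is charged twice, the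
-- superadditive `excess` once for the total width.
cost-split : ∀ E h a b → cost E h a + cost E h b ≤ 2 * base E h + excess E h (a + b)
cost-split E h a b = begin
  cost E h a + cost E h b                         ≡⟨ lemma (base E h) (excess E h a) (excess E h b) ⟩
  2 * base E h + (excess E h a + excess E h b)    ≤⟨ +-monoʳ-≤ (2 * base E h) (excess-superadditive E h a b) ⟩
  2 * base E h + excess E h (a + b)               ∎
  where
  open ≤-Reasoning
  lemma : ∀ p x y → (p + x) + (p + y) ≡ 2 * p + (x + y)
  lemma = solve-∀

-- Adding `E + h + 2` turns the recurrence of `base` into exact doubling.
base-closed : ∀ E h → base E h + (E + h + 2) ≡ 2 ^ h * (E + 2)
base-closed E zero    = lemma E
  where
  lemma : ∀ E → E + 0 + 2 ≡ 1 * (E + 2)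
  lemma = solve-∀
base-closed E (suc h) = trans (lemma E h (base E h))
  (trans (cong (2 *_) (base-closed E h)) (sym (*-assoc 2 (2 ^ h) (E + 2))))
  where
  lemma : ∀ E h b → (E + suc h) + 2 * b + (E + suc h + 2) ≡ 2 * (b + (E + h + 2))
  lemma = solve-∀

-- The remainder term makes the geometric sum telescope.
excess-telescopes : ∀ E h a → excess E h a + a /2^ (E + h) ≤ a /2^ E
excess-telescopes E zero    a = ≤-reflexive (cong (a /2^_) (+-identityʳ E))
excess-telescopes E (suc h) a = begin
  (q + excess E h a) + q           ≡⟨ lemma q (excess E h a) ⟩
  excess E h a + (q + q)           ≤⟨ +-monoʳ-≤ (excess E h a) q+q≤ ⟩
  excess E h a + a /2^ (E + h)     ≤⟨ excess-telescopes E h a ⟩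
  a /2^ E                          ∎
  where
  open ≤-Reasoning
  q = a /2^ (E + suc h)
  q+q≤ : q + q ≤ a /2^ (E + h)
  q+q≤ = subst (λ e → a /2^ e + a /2^ e ≤ a /2^ (E + h)) (sym (+-suc E h)) (/2^-halve a (E + h))
  lemma : ∀ q x → (q + x) + q ≡ x + (q + q)
  lemma = solve-∀

cost≤ : ∀ L h a b → a ≤ 2 ^ suc L * b → 2 ^ h ≤ 2 * b → cost (suc L) h a ≤ 7 * (b * (L + 1))
cost≤ L h a b a≤ 2^h≤ = begin
  base E h + excess E h a   ≤⟨ +-mono-≤ base≤ excess≤ ⟩
  -- With `E = L + 1` this is `7 * b + 2 * b * L`; another `5 * b * L` completes it to
  -- `7 * b * (L + 1)`.
  2 * b * (E + 2) + b       ≤⟨ m≤m+n _ (b * (5 * L)) ⟩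
  2 * b * (E + 2) + b + b * (5 * L) ≡⟨ lemma b L ⟩
  7 * (b * (L + 1))         ∎
  where
  open ≤-Reasoning
  E = suc L
  instance _ = m^n≢0 2 E
  base≤ : base E h ≤ 2 * b * (E + 2)
  base≤ = ≤-trans (m≤m+n (base E h) _)
    (≤-trans (≤-reflexive (base-closed E h)) (*-monoˡ-≤ (E + 2) 2^h≤))
  excess≤ : excess E h a ≤ b
  excess≤ = begin
    excess E h a          ≤⟨ ≤-trans (m≤m+n _ _) (excess-telescopes E h a) ⟩
    a / 2 ^ E             ≤⟨ /-monoˡ-≤ (2 ^ E) a≤ ⟩
    2 ^ E * b / 2 ^ E     ≡⟨ cong (_/ 2 ^ E) (*-comm (2 ^ E) b) ⟩
    b * 2 ^ E / 2 ^ E     ≡⟨ m*n/n≡m b (2 ^ E) ⟩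
    b                     ∎
  lemma : ∀ b L → 2 * b * (suc L + 2) + b + b * (5 * L) ≡ 7 * (b * (L + 1))
  lemma = solve-∀

n<2^[1+⌊log₂n⌋] : ∀ n → n < 2 ^ suc (log₂ n)
n<2^[1+⌊log₂n⌋] n = ≰⇒> λ 2^≤n → <-irrefl refl
  (subst (_≤ log₂ n) (⌊log₂[2^n]⌋≡n (suc (log₂ n))) (⌊log₂⌋-mono-≤ 2^≤n))

-- The extra one in the exponent absorbs both roundings: the power strictly exceeds `m / n`, hence
-- is at least `suc (m / n)`.
m≤2^[1+⌊log₂m/n⌋]*n : ∀ m n (n>0 : 1 ≤ n) → m ≤ 2 ^ suc (⌊log₂ m / n ⌋ n>0) * n
m≤2^[1+⌊log₂m/n⌋]*n m n n>0 = <⇒≤ (<-≤-trans (m<[1+m/n]*n m n) (*-monoˡ-≤ n (n<2^[1+⌊log₂n⌋] (m / n))))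
  where instance _ = >-nonZero n>0

∃2^∈⟨n,2n] : ∀ {n} → 1 ≤ n → ∃ λ h → n < 2 ^ h × 2 ^ h ≤ 2 * n
∃2^∈⟨n,2n] {suc zero} _ = 1 , ≤-refl , ≤-refl
∃2^∈⟨n,2n] {suc n@(suc _)} _ with ∃2^∈⟨n,2n] {n} (s≤s z≤n)
... | h , n<2^h , 2^h≤2n with suc n <? 2 ^ h
... | yes 1+n<2^h = h , 1+n<2^h , ≤-trans 2^h≤2n (*-monoʳ-≤ 2 (n≤1+n n))
-- Now `2 ^ h` is exactly `suc n`, and the strict lower bound forces the next power.
... | no  1+n≮2^h = suc h ,
  subst (suc (suc n) ≤_) (sym (2^-double 0 h)) (+-mono-≤ (0<2^ h) n<2^h) ,
  *-monoʳ-≤ 2 (≮⇒≥ 1+n≮2^h)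

-- Searching a two-dimensional slice.

module Slice {m} {n : Fin (2 + m) → ℕ} (origin : Point n)
             (c : Point (λ i → n (suc (suc i)))) where

  open Search origin

  X Y : Point n → ℕ
  X t = toℕ (t zero)
  Y t = toℕ (t (suc zero))

  InSlice : Region
  InSlice t = (λ i → t (suc (suc i))) ≈ₚ c

  at : ∀ {x y} → x < n zero → y < n (suc zero) → Point n
  at x< y< zero          = fromℕ< x<
  at x< y< (suc zero)    = fromℕ< y<
  at x< y< (suc (suc i)) = c i

  admissible-at : ∀ {x y t a} (x< : x < n zero) (y< : y < n (suc zero)) → InSlice t →
                  Admissible t (at x< y<) a →
                  Says (a zero) (X t) x ⊎ Says (a (suc zero)) (Y t) y
  admissible-at {t = t} {a} x< y< sl (zero , cl) =
    inj₁ (subst (Says (a zero) (X t)) (toℕ-fromℕ< x<) (claim⇒says a zero cl))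
  admissible-at {t = t} {a} x< y< sl (suc zero , cl) =
    inj₂ (subst (Says (a (suc zero)) (Y t)) (toℕ-fromℕ< y<) (claim⇒says a (suc zero) cl))
  -- From the third coordinate on the query agrees with the target, so no strict inequality is true
  -- there.
  admissible-at {a = a} x< y< sl (suc (suc i) , cl) =
    contradiction (claim⇒says a (suc (suc i)) cl) (says-irrefl (a (suc (suc i))) (cong toℕ (sl i)))

  query-at : ∀ {S k x y} → S ⊆ InSlice → x < n zero → y < n (suc zero) →
             (∀ b b′ → Searchable (λ t → S t × (Says b (X t) x ⊎ Says b′ (Y t) y)) k) →
             Searchable S (suc k)
  query-at sl x< y< W = query (at x< y<) λ a →
    shrink (λ (St , adm) → St , admissible-at x< y< (sl St) adm) (W (a zero) (a (suc zero)))

  record Rect (l r u v : ℕ) (t : Point n) : Set where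
    constructor rect
    field
      inSlice : InSlice t
      l≤X     : l ≤ X t
      X<r     : X t < r
      u≤Y     : u ≤ Y t
      Y<v     : Y t < v

  -- Row y is exhausted outside [p, q): everything left of p is removed on the
  -- side of the row (inclusive) denied by b, and everything from q on is removed
  -- on the side denied by b′.
  Trimmed : (y : ℕ) (b b′ : Bool) (p q : ℕ) → Region
  Trimmed y b b′ p q t = (Denies b (Y t) y → p ≤ X t) × (Denies b′ (Y t) y → X t < q)

  -- Binary search for the cut among `p` to `q`, ends included, hence at most `2 ^ g` candidates.
  -- The answer `e` on the column decides which bound moves, and the answer `e′` on the row becomes
  -- its bit: where `e′` is denied, `e` must be true.
  searchRow : ∀ {S : Region} {y k l r} → S ⊆ InSlice → y < n (suc zero) → r ≤ n zero →
    (∀ b b′ x → l ≤ x → x ≤ r → Searchable (λ t → S t × Trimmed y b b′ x x t) k) →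
    ∀ g b b′ p q → l ≤ p → p ≤ q → q ≤ r → q < p + 2 ^ g →
    Searchable (λ t → S t × Trimmed y b b′ p q t) (g + k)
  searchRow {S} {y} {k} sl y< r≤ end zero b b′ p q l≤p p≤q q≤r q<p+1
    with refl ← ≤-antisym p≤q (s≤s⁻¹ (subst (q <_) (+-comm p 1) q<p+1)) = end b b′ p l≤p q≤r
  searchRow {S} {y} {k} sl y< r≤ end (suc g) b b′ p q l≤p p≤q q≤r q<
    with q <? p + 2 ^ g | blockEnd p g
  -- Here the pivot `x` would not lie below `q`, so one query is wasted; otherwise `x < q` keeps the
  -- queried column in the grid.
  ... | yes q<′ | _ = pad (n≤1+n _) (searchRow sl y< r≤ end g b b′ p q l≤p p≤q q≤r q<′)
  ... | no  q≮  | x , 1+x≡ , p≤x = query-at (sl ∘ proj₁) (≤-trans x<q (≤-trans q≤r r≤)) y< branch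
    where
    x<q : x < q
    x<q = subst (_≤ q) (sym 1+x≡) (≮⇒≥ q≮)
    branch : ∀ e e′ → Searchable
      (λ t → (S t × Trimmed y b b′ p q t) × (Says e (X t) x ⊎ Says e′ (Y t) y)) (g + k)
    branch false e′ = shrink
      (λ ((St , left , _) , says) → St , left , λ den →
        [ (λ X<x → X<x) , (λ s → contradiction den (¬says∧denies e′ s)) ]′ says)
      (searchRow sl y< r≤ end g b e′ p x l≤p p≤x (≤-trans (<⇒≤ x<q) q≤r) (≤-reflexive 1+x≡))
    branch true e′ = shrink
      (λ ((St , _ , right) , says) → St , (λ den →
        [ (λ x<X → x<X) , (λ s → contradiction den (¬says∧denies e′ s)) ]′ says) , right)
      (searchRow sl y< r≤ end g e′ b′ (suc x) q (≤-trans l≤p (m≤n⇒m≤1+n p≤x)) x<q q≤r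
        (subst (q <_) (trans (2^-double p g) (cong (_+ 2 ^ g) (sym 1+x≡))) q<))

  -- On a side denied by both bits, `x ≤ X` and `X < x` clash. Equal bits thus remove the row and
  -- one half, and `one` pays for the other half. Opposite bits exhaust the row and confine each
  -- half to its own side of `x`; `two` pays for both parts.
  splitRow : ∀ {l r u v y x k} {K : ℕ → ℕ} → x ≤ r →
    K (r ∸ l) ≤ k → K (x ∸ l) + K (r ∸ x) ≤ k →
    (∀ l′ r′ → r′ ≤ r → Searchable (Rect l′ r′ u y) (K (r′ ∸ l′))) →
    (∀ l′ r′ → r′ ≤ r → Searchable (Rect l′ r′ (suc y) v) (K (r′ ∸ l′))) →
    ∀ b b′ → Searchable (λ t → Rect l r u v t × Trimmed y b b′ x x t) k
  splitRow {l} {r} x≤r one two below above false false =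
    shrink (λ { (rect sl l≤ <r u≤ <v , left , right) →
                rect sl l≤ <r u≤ (≰⇒> λ y≤ → <⇒≱ (right y≤) (left y≤)) })
      (pad one (below l r ≤-refl))
  splitRow {l} {r} x≤r one two below above true true =
    shrink (λ { (rect sl l≤ <r u≤ <v , left , right) →
                rect sl l≤ <r (≰⇒> λ ≤y → <⇒≱ (right ≤y) (left ≤y)) <v })
      (pad one (above l r ≤-refl))
  splitRow {l} {r} {u} {v} {y} {x} x≤r one two below above false true =
    shrink parts (pad two (union (below l x x≤r) (above x r ≤-refl)))
    where
    parts : ∀ {t} → Rect l r u v t × Trimmed y false true x x t →
            (Rect l x u y ∪ Rect x r (suc y) v) t
    parts {t} (rect sl l≤ <r u≤ <v , left , right) with <-cmp (Y t) y
    ... | tri< Y<y _ _ = inj₁ (rect sl l≤ (right (<⇒≤ Y<y)) u≤ Y<y)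
    ... | tri≈ _ Y≡y _ = contradiction (left (≤-reflexive (sym Y≡y))) (<⇒≱ (right (≤-reflexive Y≡y)))
    ... | tri> _ _ y<Y = inj₂ (rect sl (left (<⇒≤ y<Y)) <r y<Y <v)
  splitRow {l} {r} {u} {v} {y} {x} x≤r one two below above true false =
    shrink parts (pad two (union (above l x x≤r) (below x r ≤-refl)))
    where
    parts : ∀ {t} → Rect l r u v t × Trimmed y true false x x t →
            (Rect l x (suc y) v ∪ Rect x r u y) t
    parts {t} (rect sl l≤ <r u≤ <v , left , right) with <-cmp (Y t) y
    ... | tri< Y<y _ _ = inj₂ (rect sl (left (<⇒≤ Y<y)) <r u≤ Y<y)
    ... | tri≈ _ Y≡y _ = contradiction (left (≤-reflexive Y≡y)) (<⇒≱ (right (≤-reflexive (sym Y≡y))))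
    ... | tri> _ _ y<Y = inj₁ (rect sl l≤ (right (<⇒≤ y<Y)) y<Y <v)

  searchRect : ∀ E h l r u v → r ≤ n zero → v ≤ n (suc zero) → v < u + 2 ^ h →
               Searchable (Rect l r u v) (cost E h (r ∸ l))
  searchRect E zero l r u v r≤ v≤ v<u+1 = empty λ { (rect _ _ _ u≤Y Y<v) →
    <⇒≱ (≤-<-trans u≤Y Y<v) (s≤s⁻¹ (subst (v <_) (+-comm u 1) v<u+1)) }
  searchRect E (suc h) l r u v r≤ v≤ v< with v <? u + 2 ^ h | blockEnd u h | l ≤? r
  ... | yes v<′ | _ | _ = pad (cost-mono E h (r ∸ l)) (searchRect E h l r u v r≤ v≤ v<′)
  -- An inverted interval is empty; setting it aside keeps the truncated `r ∸ l` a true width.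
  ... | no _    | _ | no l≰r = empty λ { (rect _ l≤X X<r _ _) → l≰r (≤-trans l≤X (<⇒≤ X<r)) }
  ... | no v≮   | y , 1+y≡ , u≤y | yes l≤r =
    -- The two initial bits `true` are arbitrary: the sides of the rectangle give both bounds in
    -- every row.
    subst (Searchable _) (cost-suc E h (r ∸ l)) (shrink (λ R → R , (λ _ → Rect.l≤X R) , (λ _ → Rect.X<r R))
      (searchRow Rect.inSlice (≤-trans y<v v≤) r≤ cut
        (rowCost E h (r ∸ l)) true true l r ≤-refl l≤r ≤-refl
        (subst (_< l + 2 ^ rowCost E h (r ∸ l)) (m+[n∸m]≡n l≤r)
          (+-monoʳ-< l (<2^rowCost E h (r ∸ l))))))
    where
    y<v : y < v
    y<v = subst (_≤ v) (sym 1+y≡) (≮⇒≥ v≮)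
    cut : ∀ b b′ x → l ≤ x → x ≤ r →
          Searchable (λ t → Rect l r u v t × Trimmed y b b′ x x t) (2 * base E h + excess E h (r ∸ l))
    cut b b′ x l≤x x≤r = splitRow {K = cost E h} x≤r
      (+-monoˡ-≤ (excess E h (r ∸ l)) (m≤m+n (base E h) _))
      (subst (λ a → cost E h (x ∸ l) + cost E h (r ∸ x) ≤ 2 * base E h + excess E h a)
        (trans (+-comm (x ∸ l) _) (trans (sym (+-∸-assoc (r ∸ x) l≤x)) (cong (_∸ l) (m∸n+n≡m x≤r))))
        (cost-split E h (x ∸ l) (r ∸ x)))
      (λ l′ r′ r′≤r → searchRect E h l′ r′ u y (≤-trans r′≤r r≤) (≤-trans (<⇒≤ y<v) v≤) (≤-reflexive 1+y≡))
      (λ l′ r′ r′≤r → searchRect E h l′ r′ (suc y) v (≤-trans r′≤r r≤) v≤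
        (subst (v <_) (trans (2^-double u h) (cong (_+ 2 ^ h) (sym 1+y≡))) v<))
      b b′

-- Assembly over all slices.

theorem4 : (m : ℕ) → ∃ λ (C : ℕ) →
    (n : Fin (suc (suc m)) → ℕ) →
    (sorted : (i j : Fin (suc (suc m))) → Data.Fin._≤_ i j → n j ≤ n i) →
    (pos : (i : Fin (suc (suc m))) → 1 ≤ n i) →
    qc≤ n (C * (∏ (λ (i : Fin (suc m)) → n (suc i)) * (⌊log₂ n zero / n (suc zero) ⌋ (pos (suc zero)) + 1)))
theorem4 m = 7 , λ n _ pos → search n pos
  where
  search : ∀ n (pos : ∀ i → 1 ≤ n i) →
           qc≤ n (7 * (∏ (n ∘ suc) * (⌊log₂ n zero / n (suc zero) ⌋ (pos (suc zero)) + 1)))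
  -- The recursion needs `2 ^ h` above the number of rows, the cost bound needs it linear in that
  -- number.
  search n pos with ∃2^∈⟨n,2n] (pos (suc zero))
  ... | h , n₂<2^h , 2^h≤2n₂ =
    (λ (A , F) → A , λ t → F t tt)
      (subst (Searchable (λ _ → ⊤)) (regroup (n (suc zero)) (∏ (λ i → n (suc (suc i)))) (L + 1))
        (fibrewise (λ t i → t (suc (suc i))) λ c →
          let open Slice origin c in
          shrink (λ {t} (_ , sl) → rect sl z≤n (toℕ<n (t zero)) z≤n (toℕ<n (t (suc zero))))
            (pad (cost≤ L h (n zero) (n (suc zero)) n₁≤ 2^h≤2n₂)
              (searchRect (suc L) h 0 (n zero) 0 (n (suc zero)) ≤-refl ≤-refl n₂<2^h))))
    where
    origin : Point n
    origin i = fromℕ< (pos i)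
    open Search origin
    L = ⌊log₂ n zero / n (suc zero) ⌋ (pos (suc zero))
    n₁≤ : n zero ≤ 2 ^ suc L * n (suc zero)
    n₁≤ = m≤2^[1+⌊log₂m/n⌋]*n (n zero) (n (suc zero)) (pos (suc zero))
    regroup : ∀ a p l → p * (7 * (a * l)) ≡ 7 * (a * p * l)
    regroup = solve-∀
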